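{- Let $n\ge 1$. Every clique in the partition graph $G_n$ is contained in a star-simplex or in a top-simplex.
   Context: A partition of $n$ is a weakly decreasing sequence $\lambda=(\lambda_1\ge\cdots\ge\lambda_\ell>0)$ of positive integers with sum $n$, identified with its Ferrers diagram ($\lambda_i$ left-justified cells in row $i$); set $\lambda_{\ell+1}=0$. The partition graph $G_n$ has as vertices all partitions of $n$; two distinct partitions are adjacent if one is obtained from the other by removing one cell from a row, adding it to another row (possibly a new row of length $0$), and reordering the row lengths into weakly decreasing order. A clique is a finite nonempty set of pairwise adjacent vertices. A removable corner of $\lambda$ is the last cell of a row whose length is strictly greater than that of the next row; an addable corner is a position where a cell can be added so that the result is again a Ferrers diagram of a partition (row $\ell+1$ allowed). Write $r(\cdot)$ for the row number of a corner. For a removable corner $c$ and an addable corner $a$ of $\lambda$ with $r(c)\ne r(a)$, remove $c$ (decrease row length $\lambda_{r(c)}$ by $1$), add a cell at $a$ (increase $\lambda_{r(a)}$ by $1$), and reorder row lengths. If the result is a partition of $n$ different from $\lambda$, the transfer is called admissible and the result is denoted $\lambda(c\to a)$. The neighbors of $\lambda$ in $G_n$ are exactly the partitions $\lambda(c\to a)$ for admissible transfers. A star-simplex based at $(\lambda,c)$, with $c$ a removable corner of $\lambda$, is a set $\{\lambda\}\cup\{\lambda(c\to a):a\in A\}$, where $A$ is a finite (possibly empty) set of addable corners such that every transfer $\lambda(c\to a)$, $a\in A$, is admissible. A top-simplex based at $(\lambda,a)$, with $a$ an addable corner of $\lambda$, is a set $\{\lambda\}\cup\{\lambda(c\to a):c\in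 C\}$, where $C$ is a finite (possibly empty) set of removable corners such that every transfer $\lambda(c\to a)$, $c\in C$, is admissible. Here $\lambda$ ranges over partitions of $n$. -}

module Defs where

open import Data.Fin.Base using (Fin; suc; inject₁)
open import Data.List.Base using (List; []; _∷_; length; filter)
open import Data.List.Membership.Propositional using (_∈_)
open import Data.List.Relation.Binary.Permutation.Propositional using (_↭_)
open import Data.List.Relation.Unary.All using (All)
open import Data.List.Relation.Unary.AllPairs using (AllPairs)
open import Data.List.Relation.Unary.Linked using (Linked)
open import Data.Nat.Base using (ℕ; suc; pred; _<_; _>_; _≥_)
open import Data.Nat.ListAction using (sum)
open import Data.Nat.Properties using (_<?_)
open import Data.Product.Base using (∃-syntax; _×_)
open import Data.Sum.Base using (_⊎_)
open import Data.Vec.Functional as Vector using (Vector; updateAt; toList)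
open import Level using (0ℓ)
open import Relation.Binary.PropositionalEquality.Core using (_≡_; _≢_)
open import Relation.Unary using (Pred)

-- The fields other than `parts` have at most one proof each, so `_≡_` on partitions is
-- equality of their lists of parts.
record Partition (n : ℕ) : Set where
  field
    parts      : List ℕ
    decreasing : Linked _≥_ parts
    positive   : All (0 <_) parts
    sum-parts  : sum parts ≡ n

open Partition public

ℓ : ∀ {n} → Partition n → ℕ
ℓ p = length (parts p)

-- The row lengths followed by a single 0, the length of the empty row below
-- the diagram.
padded : (xs : List ℕ) → Vector ℕ (suc (length xs))
padded []       = λ _ → 0
padded (x ∷ xs) = x Vector.∷ padded xs

-- Rows are numbered from 0, so `rows p i` is the part with index i + 1.
rows : ∀ {n} (p : Partition n) → Vector ℕ (suc (ℓ p))
rows p = padded (parts p)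

-- q is the result of moving a cell from row i to row j and reordering the
-- rows.  Empty rows are dropped; as the parts of q are weakly decreasing,
-- q is determined by p, i and j.
record Move {n} (p : Partition n) (i j : Fin (suc (ℓ p))) (q : Partition n) : Set where
  field
    distinct-rows : i ≢ j
    cell-in-row   : rows p i > 0
    reordered     : filter (0 <?_) (toList (updateAt (updateAt (rows p) i pred) j suc)) ↭ parts q

Obtained : ∀ {n} → Partition n → Partition n → Set
Obtained p q = ∃[ i ] ∃[ j ] Move p i j q

Adjacent : ∀ {n} → Partition n → Partition n → Set
Adjacent p q = p ≢ q × (Obtained p q ⊎ Obtained q p)

-- A finite set of vertices is enumerated without repetition; that there are
-- no repetitions follows from `pairwise`, as adjacent vertices are distinct.
record Clique (n : ℕ) : Set where
  field
    vertices : List (Partition n)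
    nonempty : vertices ≢ []
    pairwise : AllPairs Adjacent vertices

-- A corner is determined by its row.
record RemovableCorner {n} (p : Partition n) : Set where
  field
    row       : Fin (ℓ p)
    removable : rows p (inject₁ row) > rows p (suc row)

  r : Fin (suc (ℓ p))
  r = inject₁ row

record AddableCorner {n} (p : Partition n) : Set where
  field
    r       : Fin (suc (ℓ p))
    addable : Linked _≥_ (toList (updateAt (rows p) r suc))

-- The transfer of c to a is admissible with result q.
_⟨_⇒_⟩_ : ∀ {n} (p : Partition n) → RemovableCorner p → AddableCorner p → Partition n → Set
p ⟨ c ⇒ a ⟩ q = Move p (RemovableCorner.r c) (AddableCorner.r a) q × q ≢ p

Admissible : ∀ {n} (p : Partition n) → RemovableCorner p → AddableCorner p → Set
Admissible p c a = ∃[ q ] p ⟨ c ⇒ a ⟩ q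

record StarSimplex (n : ℕ) : Set where
  field
    base       : Partition n
    c          : RemovableCorner base
    A          : List (AddableCorner base)
    admissible : ∀ {a} → a ∈ A → Admissible base c a

  vertices : Pred (Partition n) 0ℓ
  vertices q = q ≡ base ⊎ (∃[ a ] (a ∈ A × base ⟨ c ⇒ a ⟩ q))

record TopSimplex (n : ℕ) : Set where
  field
    base       : Partition n
    a          : AddableCorner base
    C          : List (RemovableCorner base)
    admissible : ∀ {c} → c ∈ C → Admissible base c a

  vertices : Pred (Partition n) 0ℓ
  vertices q = q ≡ base ⊎ (∃[ c ] (c ∈ C × base ⟨ c ⇒ a ⟩ q))

_⊆ˢ_ : ∀ {n} → Clique n → StarSimplex n → Set
K ⊆ˢ S = ∀ {q} → q ∈ Clique.vertices K → StarSimplex.vertices S q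

_⊆ᵗ_ : ∀ {n} → Clique n → TopSimplex n → Set
K ⊆ᵗ T = ∀ {q} → q ∈ Clique.vertices K → TopSimplex.vertices T q

{-# OPTIONS --safe #-}
-- Record a partition p by its columns, column k p being the number of rows longer than k.
-- Moving a cell from a row of length x + 1 to a row of length y adds the vector
-- e_y − e_x to the columns, and the columns determine p.  Among the neighbours of p, adding
-- e_y − e_x and e_y′ − e_x′ gives adjacent partitions only if x ≡ x′ or y ≡ y′, so in a
-- clique containing p either all the x agree or all the y agree.  As the columns of the
-- result still decrease, the row with index column x p − 1 ends in a removable corner and
-- the row with index column y p has an addable corner, and they realise the move.
module Submission where

open import Data.Empty using (⊥; ⊥-elim)
open import Data.Fin.Base as Fin using (Fin; zero; suc; toℕ; fromℕ<; inject₁)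
open import Data.Fin.Properties as Fin using (toℕ-fromℕ<; toℕ-inject₁)
open import Data.List.Base using (List; []; _∷_; map; length; filter)
open import Data.List.Membership.Propositional using (_∈_)
open import Data.List.Relation.Binary.Permutation.Propositional using (_↭_; ↭-sym; ↭-trans; ↭-reflexive)
open import Data.List.Relation.Binary.Permutation.Propositional.Properties using (map⁺; All-resp-↭)
open import Data.List.Relation.Unary.All as All using (All; []; _∷_)
open import Data.List.Relation.Unary.All.Properties using (all-filter)
open import Data.List.Relation.Unary.AllPairs using (AllPairs; []; _∷_)
open import Data.List.Relation.Unary.AllPairs.Properties using (tabulate⁺-<)
open import Data.List.Relation.Unary.Any using (here; there)
open import Data.List.Relation.Unary.Linked as Linked using (Linked)
open import Data.List.Relation.Unary.Linked.Properties using (Linked⇒AllPairs; AllPairs⇒Linked)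
import Data.List.Sort as Sort
open import Data.Nat.Base
  using (ℕ; zero; suc; pred; _+_; _≤_; _<_; _≥_; z≤n; s≤s; s≤s⁻¹; z<s)
open import Data.Nat.ListAction using (sum)
open import Data.Nat.ListAction.Properties using (sum-↭)
open import Data.Nat.Properties
open import Data.Nat.Solver using (module +-*-Solver)
open import Data.Product.Base using (∃-syntax; _×_; _,_)
open import Data.Sum.Base as Sum using (_⊎_; inj₁; inj₂)
open import Data.Vec.Functional as Vector using (Vector; updateAt; toList)
open import Data.Vec.Functional.Properties using (updateAt-updates; updateAt-minimal)
open import Function.Base using (_∘_; flip)
open import Level using (0ℓ)
open import Relation.Binary.Construct.Flip.EqAndOrd using () renaming (decTotalOrder to flip-decTotalOrder)
open import Relation.Binary.Definitions using (tri<; tri≈; tri>)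
open import Relation.Binary.PropositionalEquality
  using (_≡_; _≢_; refl; sym; trans; cong; cong₂; subst; ≢-sym; module ≡-Reasoning)
open import Relation.Nullary using (¬_; yes; no; contradiction)
open import Relation.Unary using (Pred)
open import Defs

open +-*-Solver using (solve; _:+_; _:=_)

-- Indicator functions on row lengths

δ : ℕ → ℕ → ℕ
δ zero    zero    = 1
δ zero    (suc _) = 0
δ (suc _) zero    = 0
δ (suc x) (suc k) = δ x k

δ-refl : ∀ x → δ x x ≡ 1
δ-refl zero    = refl
δ-refl (suc x) = δ-refl x

δ-≢ : ∀ {x k} → x ≢ k → δ x k ≡ 0
δ-≢ {zero}  {zero}  x≢k = contradiction refl x≢k
δ-≢ {zero}  {suc k} x≢k = refl
δ-≢ {suc x} {zero}  x≢k = refl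
δ-≢ {suc x} {suc k} x≢k = δ-≢ (x≢k ∘ cong suc)

δ-support : ∀ {x k} → 0 < δ x k → x ≡ k
δ-support {x} {k} 0<δ with x ≟ k
... | yes x≡k = x≡k
... | no  x≢k = contradiction (δ-≢ x≢k) (>⇒≢ 0<δ)

below : ℕ → ℕ → ℕ
below _       zero    = 0
below zero    (suc _) = 1
below (suc k) (suc x) = below k x

below-< : ∀ {k x} → k < x → below k x ≡ 1
below-< {zero}  {suc x} _   = refl
below-< {suc k} {suc x} k<x = below-< (s≤s⁻¹ k<x)

below-≥ : ∀ {k x} → x ≤ k → below k x ≡ 0
below-≥ {k}     {zero}  _   = refl
below-≥ {suc k} {suc x} x≤k = below-≥ (s≤s⁻¹ x≤k)

below-suc : ∀ k x → below k (suc x) ≡ below k x + δ x k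
below-suc zero    zero    = refl
below-suc zero    (suc x) = refl
below-suc (suc k) zero    = refl
below-suc (suc k) (suc x) = below-suc k x

below≤1 : ∀ k x → below k x ≤ 1
below≤1 k       zero    = z≤n
below≤1 zero    (suc x) = ≤-refl
below≤1 (suc k) (suc x) = below≤1 k x

below-antitone : ∀ {k m} x → k ≤ m → below m x ≤ below k x
below-antitone                 zero    k≤m = z≤n
below-antitone {zero}  {m}     (suc x) k≤m = below≤1 m (suc x)
below-antitone {suc k} {suc m} (suc x) k≤m = below-antitone x (s≤s⁻¹ k≤m)

-- Columns of a list of rows, and the effect of moving a cell

column : ℕ → List ℕ → ℕ
column k xs = sum (map (below k) xs)

column-antitone : ∀ {k m} xs → k ≤ m → column m xs ≤ column k xs
column-antitone []       k≤m = z≤n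
column-antitone (x ∷ xs) k≤m = +-mono-≤ (below-antitone x k≤m) (column-antitone xs k≤m)

column-↭ : ∀ k {xs ys} → xs ↭ ys → column k xs ≡ column k ys
column-↭ k xs↭ys = sum-↭ (map⁺ (below k) xs↭ys)

column-filter : ∀ k xs → column k (filter (0 <?_) xs) ≡ column k xs
column-filter k []           = refl
column-filter k (zero ∷ xs)  = column-filter k xs
column-filter k (suc x ∷ xs) = cong (below k (suc x) +_) (column-filter k xs)

column-padded : ∀ k xs → column k (toList (padded xs)) ≡ column k xs
column-padded k []       = refl
column-padded k (x ∷ xs) = cong (below k x +_) (column-padded k xs)

-- The change is written additively because subtraction on `ℕ` truncates; `column-move` and
-- `balance` keep this form.
column-updateAt : ∀ k {n} (f : Vector ℕ n) i (h : ℕ → ℕ) →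
  column k (toList (updateAt f i h)) + below k (f i) ≡ column k (toList f) + below k (h (f i))
column-updateAt k {suc n} f zero h =
  solve 3 (λ a b c → (a :+ b) :+ c := (c :+ b) :+ a) refl
    (below k (h (f zero))) (column k (toList (Vector.tail f))) (below k (f zero))
column-updateAt k {suc n} f (suc i) h = begin
  (b + c′) + below k (f (suc i))       ≡⟨ +-assoc b c′ _ ⟩
  b + (c′ + below k (f (suc i)))       ≡⟨ cong (b +_) (column-updateAt k (Vector.tail f) i h) ⟩
  b + (c + below k (h (f (suc i))))    ≡⟨ +-assoc b c _ ⟨
  (b + c) + below k (h (f (suc i)))    ∎
  where
  open ≡-Reasoning
  b  = below k (f zero)
  c  = column k (toList (Vector.tail f))
  c′ = column k (toList (updateAt (Vector.tail f) i h))

-- Only column `x` loses a cell and only column `f j` gains one. As `i ≢ j`, the removal leaves row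
-- `j` alone, so the target column can be read off the original rows.
column-move : ∀ k {n} (f : Vector ℕ n) {i j} {x} → i ≢ j → f i ≡ suc x →
  column k (toList (updateAt (updateAt f i pred) j suc)) + δ x k ≡ column k (toList f) + δ (f j) k
column-move k f {i} {j} {x} i≢j fi = +-cancelʳ-≡ (b + below k x) _ _ (begin
  (c₂ + δ x k) + (b + below k x)
    ≡⟨ solve 4 (λ a b c d → (a :+ b) :+ (c :+ d) := (a :+ c) :+ (d :+ b))
         refl c₂ (δ x k) b (below k x) ⟩
  (c₂ + b) + (below k x + δ x k)      ≡⟨ cong₂ _+_ added (sym (below-suc k x)) ⟩
  (c₁ + (b + δ (f j) k)) + below k (suc x)
    ≡⟨ solve 4 (λ a b c d → (a :+ (b :+ c)) :+ d := (a :+ d) :+ (b :+ c))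
         refl c₁ b (δ (f j) k) (below k (suc x)) ⟩
  (c₁ + below k (suc x)) + (b + δ (f j) k) ≡⟨ cong (_+ (b + δ (f j) k)) removed ⟩
  (c + below k x) + (b + δ (f j) k)
    ≡⟨ solve 4 (λ a b c d → (a :+ b) :+ (c :+ d) := (a :+ d) :+ (c :+ b))
         refl c (below k x) b (δ (f j) k) ⟩
  (c + δ (f j) k) + (b + below k x)   ∎)
  where
  open ≡-Reasoning
  g  = updateAt f i pred
  b  = below k (f j)
  c  = column k (toList f)
  c₁ = column k (toList g)
  c₂ = column k (toList (updateAt g j suc))

  removed : c₁ + below k (suc x) ≡ c + below k x
  removed = subst (λ z → c₁ + below k z ≡ c + below k (pred z)) fi (column-updateAt k f i pred)

  added : c₂ + b ≡ c₁ + (b + δ (f j) k)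
  added = trans
    (subst (λ z → c₂ + below k z ≡ c₁ + below k (suc z))
      (updateAt-minimal j i f (≢-sym i≢j)) (column-updateAt k g j suc))
    (cong (c₁ +_) (below-suc k (f j)))

-- Decreasing lists are determined by their columns

Decreasing : List ℕ → Set
Decreasing = AllPairs _≥_

column-bounded : ∀ {k} {xs} → All (_≤ k) xs → column k xs ≡ 0
column-bounded []         = refl
column-bounded (x≤k ∷ ps) = cong₂ _+_ (below-≥ x≤k) (column-bounded ps)

column-head≤ : ∀ {k x xs} → All (x ≥_) xs → x ≤ k → column k (x ∷ xs) ≡ 0
column-head≤ x≥xs x≤k = column-bounded (x≤k ∷ All.map (λ y≤x → ≤-trans y≤x x≤k) x≥xs)

-- Together with `<column⇒padded>` this is conjugation of the diagram: both inequalities say that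
-- the cell in row `i` and column `k` belongs to it.
padded>⇒<column : ∀ {k xs} → Decreasing xs → ∀ i → k < padded xs i → toℕ i < column k xs
padded>⇒<column {k} {x ∷ xs} (_ ∷ _) zero k<x rewrite below-< k<x = z<s
padded>⇒<column {k} {x ∷ xs} (x≥xs ∷ d) (suc i) k<xi with k <? x
... | yes k<x rewrite below-< k<x = s≤s (padded>⇒<column d i k<xi)
... | no  k≮x = contradiction (padded>⇒<column d i k<xi)
  (≤⇒≯ (≤-trans (≤-reflexive (m+n≡0⇒n≡0 (below k x) (column-head≤ x≥xs (≮⇒≥ k≮x)))) z≤n))

<column⇒padded> : ∀ {k xs} → Decreasing xs → ∀ i → toℕ i < column k xs → k < padded xs i
<column⇒padded> {k} {x ∷ xs} (x≥xs ∷ d) i i<c with k <? x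
... | no  k≮x = contradiction (≤-trans i<c (≤-reflexive (column-head≤ x≥xs (≮⇒≥ k≮x)))) λ ()
<column⇒padded> (_ ∷ _) zero    i<c | yes k<x = k<x
<column⇒padded> (_ ∷ d) (suc i) i<c | yes k<x rewrite below-< k<x =
  <column⇒padded> d i (s≤s⁻¹ i<c)

padded-antitone : ∀ {xs} → Decreasing xs → ∀ {i j} → i Fin.≤ j → padded xs j ≤ padded xs i
-- Conjugation is used at the column numbered by the length of row `i`: if it reached row `j`, it
-- would reach row `i`, making that row longer than itself.
padded-antitone d {i} {j} i≤j = ≮⇒≥ λ xi<xj →
  <-irrefl refl (<column⇒padded> d i (≤-<-trans i≤j (padded>⇒<column d j xi<xj)))

column≤length : ∀ k xs → column k xs ≤ length xs
column≤length k []       = z≤n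
column≤length k (x ∷ xs) = +-mono-≤ (below≤1 k x) (column≤length k xs)

-- Heads are maximal, so if they differed, the column numbered by the smaller head would be empty in
-- its own list but not in the other. Positivity lets column `0` tell an empty list from a nonempty
-- one.
columns-injective : ∀ {xs ys} → Decreasing xs → Decreasing ys →
  All (0 <_) xs → All (0 <_) ys → (∀ k → column k xs ≡ column k ys) → xs ≡ ys
columns-injective [] [] _ _ eq = refl
columns-injective [] (_ ∷ _) _ (s≤s z≤n ∷ _) eq = contradiction (eq 0) λ ()
columns-injective (_ ∷ _) [] (s≤s z≤n ∷ _) _ eq = contradiction (eq 0) λ ()
columns-injective {x ∷ xs} {y ∷ ys} (x≥xs ∷ dx) (y≥ys ∷ dy) (_ ∷ px) (_ ∷ py) eq
  with <-cmp x y
... | tri< x<y _ _ = contradiction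
  (trans (sym (cong (_+ column x ys) (below-< x<y))) (trans (sym (eq x)) (column-head≤ x≥xs ≤-refl))) λ ()
... | tri> _ _ y<x = contradiction
  (trans (sym (cong (_+ column y xs) (below-< y<x))) (trans (eq y) (column-head≤ y≥ys ≤-refl))) λ ()
... | tri≈ _ refl _ = cong (x ∷_) (columns-injective dx dy px py
  (λ k → +-cancelˡ-≡ (below k x) _ _ (eq k)))

open Sort (flip-decTotalOrder ≤-decTotalOrder) using (sort; sort-↭; sort-↗)

Linked⇒Decreasing : ∀ {xs} → Linked _≥_ xs → Decreasing xs
Linked⇒Decreasing = Linked⇒AllPairs (flip ≤-trans)

-- Columns do not see the order of the rows, so `xs` may be sorted before `columns-injective` is
-- applied.
columns⇒↭ : ∀ {xs ys} → Decreasing ys → All (0 <_) xs → All (0 <_) ys →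
  (∀ k → column k xs ≡ column k ys) → xs ↭ ys
columns⇒↭ {xs} dy px py eq = ↭-trans (↭-sym (sort-↭ xs)) (↭-reflexive
  (columns-injective (Linked⇒Decreasing (sort-↗ xs)) dy (All-resp-↭ (↭-sym (sort-↭ xs)) px) py
    (λ k → trans (column-↭ k (sort-↭ xs)) (eq k))))

-- Moves between partitions as shifts of columns

module _ {n : ℕ} where

  col : ℕ → Partition n → ℕ
  col k p = column k (parts p)

  sorted : (p : Partition n) → Decreasing (parts p)
  sorted p = Linked⇒Decreasing (decreasing p)

  parts-injective : {p q : Partition n} → parts p ≡ parts q → p ≡ q
  parts-injective {record { decreasing = d ; positive = z ; sum-parts = s }}
                  {record { decreasing = d′ ; positive = z′ ; sum-parts = s′ }} refl
    with Linked.irrelevant ≤-irrelevant d d′ | All.irrelevant ≤-irrelevant z z′ | ≡-irrelevant s s′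
  ... | refl | refl | refl = refl

  moved-rows : (p : Partition n) (i j : Fin (suc (ℓ p))) → List ℕ
  moved-rows p i j = toList (updateAt (updateAt (rows p) i pred) j suc)

  column-moved-rows : ∀ k p {i j x} → i ≢ j → rows p i ≡ suc x →
    column k (moved-rows p i j) + δ x k ≡ col k p + δ (rows p j) k
  column-moved-rows k p {i} {j} i≢j eq = trans (column-move k (rows p) i≢j eq)
    (cong (_+ δ (rows p j) k) (column-padded k (parts p)))

  -- Only columns are recorded, not the rows involved, so reversing a move just swaps `x` and `y`.
  record Shift (p q : Partition n) (x y : ℕ) : Set where
    field
      x≢y     : x ≢ y
      balance : ∀ k → col k q + δ x k ≡ col k p + δ y k

  open Shift

  Shift-sym : ∀ {p q x y} → Shift p q x y → Shift q p y x
  Shift-sym s .x≢y     = ≢-sym (x≢y s)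
  Shift-sym s .balance = sym ∘ balance s

  Obtained⇒Shift : ∀ {p q} → p ≢ q → Obtained p q → ∃[ x ] ∃[ y ] Shift p q x y
  Obtained⇒Shift {p} {q} p≢q (i , j , m) with rows p i in eq | Move.cell-in-row m
  ... | suc x | _ = x , rows p j , record { x≢y = distinct ; balance = moved }
    where
    moved : ∀ k → col k q + δ x k ≡ col k p + δ (rows p j) k
    moved k = trans
      (cong (_+ δ x k) (trans (sym (column-↭ k (Move.reordered m))) (column-filter k (moved-rows p i j))))
      (column-moved-rows k p (Move.distinct-rows m) eq)

    distinct : x ≢ rows p j
    -- A target row one cell shorter than the source would merely exchange the two lengths, leaving
    -- every column unchanged.
    distinct x≡y = p≢q (parts-injective (columns-injective (sorted p) (sorted q) (positive p) (positive q)
      λ k → +-cancelʳ-≡ (δ x k) _ _ (trans (cong (λ y → col k p + δ y k) x≡y) (sym (moved k)))))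

  Adjacent⇒Shift : ∀ {p q} → Adjacent p q → ∃[ x ] ∃[ y ] Shift p q x y
  Adjacent⇒Shift (p≢q , inj₁ o) = Obtained⇒Shift p≢q o
  Adjacent⇒Shift (p≢q , inj₂ o) with Obtained⇒Shift (≢-sym p≢q) o
  ... | x , y , s = y , x , Shift-sym s

  -- The columns of `q′` minus those of `q` are e_y′ + e_x - e_x′ - e_y, and adjacency makes this
  -- e_v - e_u. If both coordinates differ, neither positive term cancels, and the single e_v would
  -- have to supply both.
  shared-column : ∀ {p q q′ x y x′ y′} → Shift p q x y → Shift p q′ x′ y′ →
    Adjacent q q′ → x ≡ x′ ⊎ y ≡ y′
  shared-column {p} {q} {q′} {x} {y} {x′} {y′} s s′ adj with x ≟ x′ | y ≟ y′
  ... | yes x≡x′ | _        = inj₁ x≡x′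
  ... | no _     | yes y≡y′ = inj₂ y≡y′
  ... | no x≢x′  | no y≢y′  with Adjacent⇒Shift adj
  ... | u , v , t = ⊥-elim (coincidence y′≡v x≡v)
    where
    -- Adding the three balances cancels the columns of `p`, `q` and `q′`.
    balanced : ∀ k → δ y′ k + (δ x k + δ u k) ≡ δ y k + (δ x′ k + δ v k)
    balanced k = +-cancelˡ-≡ (a + (b + c)) _ _ (begin
      (a + (b + c)) + (δ y′ k + (δ x k + δ u k))
        ≡⟨ solve 6 (λ a b c d e f → (a :+ (b :+ c)) :+ (d :+ (e :+ f)) := (a :+ d) :+ ((b :+ e) :+ (c :+ f)))
             refl a b c (δ y′ k) (δ x k) (δ u k) ⟩
      (a + δ y′ k) + ((b + δ x k) + (c + δ u k))
        ≡⟨ cong₂ _+_ (sym (balance s′ k)) (cong₂ _+_ (balance s k) (balance t k)) ⟩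
      (c + δ x′ k) + ((a + δ y k) + (b + δ v k))
        ≡⟨ solve 6 (λ a b c d e f → (c :+ e) :+ ((a :+ d) :+ (b :+ f)) := (a :+ (b :+ c)) :+ (d :+ (e :+ f)))
             refl a b c (δ y k) (δ x′ k) (δ v k) ⟩
      (a + (b + c)) + (δ y k + (δ x′ k + δ v k)) ∎)
      where
      open ≡-Reasoning
      a = col k p
      b = col k q
      c = col k q′

    residue : ∀ {k} → y ≢ k → x′ ≢ k → δ y′ k + (δ x k + δ u k) ≡ δ v k
    residue {k} y≢k x′≢k = trans (balanced k) (cong₂ _+_ (δ-≢ y≢k) (cong (_+ δ v k) (δ-≢ x′≢k)))

    y′≡v : y′ ≡ v
    y′≡v = sym (δ-support (subst (0 <_) (residue y≢y′ (x≢y s′))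
      (≤-trans (≤-reflexive (sym (δ-refl y′))) (m≤m+n _ _))))

    x≡v : x ≡ v
    x≡v = sym (δ-support (subst (0 <_) (residue (≢-sym (x≢y s)) (≢-sym x≢x′))
      (≤-trans (≤-reflexive (sym (δ-refl x))) (≤-trans (m≤m+n _ _) (m≤n+m _ (δ y′ x))))))

    coincidence : y′ ≡ v → x ≡ v → ⊥
    -- At the common index the left side of `residue` is at least two, its right side one.
    coincidence refl refl = contradiction
      (m+n≡0⇒m≡0 (δ x x) (+-cancelˡ-≡ (δ x x) _ 0
        (trans (residue y≢y′ (x≢y s′)) (sym (+-identityʳ _)))))
      (>⇒≢ (≤-reflexive (sym (δ-refl x))))

  -- Strict drops of the columns next to a shift

  module _ {p q : Partition n} {x y : ℕ} (s : Shift p q x y) where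

    source-shrinks : col x q < col x p
    source-shrinks = ≤-reflexive (begin
      suc (col x q)       ≡⟨ +-comm 1 (col x q) ⟩
      col x q + 1         ≡⟨ cong (col x q +_) (sym (δ-refl x)) ⟩
      col x q + δ x x     ≡⟨ balance s x ⟩
      col x p + δ y x     ≡⟨ cong (col x p +_) (δ-≢ (≢-sym (x≢y s))) ⟩
      col x p + 0         ≡⟨ +-identityʳ _ ⟩
      col x p             ∎)
      where open ≡-Reasoning

    grows-off-source : ∀ {k} → x ≢ k → col k p ≤ col k q
    grows-off-source {k} x≢k = ≤-trans (m≤m+n _ (δ y k)) (≤-reflexive (trans (sym (balance s k))
      (trans (cong (col k q +_) (δ-≢ x≢k)) (+-identityʳ _))))

    -- Since the columns of `q` decrease, `col k p ≤ col k q ≤ col x q < col x p`. At `k = suc x`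
    -- this yields a row of length exactly `suc x`.
    drop-after-source : ∀ {k} → x < k → col k p < col x p
    drop-after-source x<k = ≤-<-trans (grows-off-source (<⇒≢ x<k))
      (≤-<-trans (column-antitone (parts q) (<⇒≤ x<k)) source-shrinks)

  module _ {p q : Partition n} {x y : ℕ} (s : Shift p q x y) where

    -- The reversed shift takes its cell from column `y`, so
    -- `col y p < col y q ≤ col k q ≤ col k p`.
    drop-before-target : ∀ {k} → k < y → col y p < col k p
    drop-before-target k<y = <-≤-trans (source-shrinks (Shift-sym s))
      (≤-trans (column-antitone (parts q) (<⇒≤ k<y)) (grows-off-source (Shift-sym s) (≢-sym (<⇒≢ k<y))))

    -- If y ≡ suc x, a single row of length y would be both source and target of the move;
    -- that the columns of q decrease rules this out.
    source≢target : col x p ≢ suc (col y p)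
    source≢target eq with <-cmp x y
    ... | tri≈ _ x≡y _ = x≢y s x≡y
    ... | tri> _ _ y<x = <-irrefl eq (s≤s (column-antitone (parts p) (<⇒≤ y<x)))
    ... | tri< x<y _ _ = <-irrefl (sym eq) (≤-<-trans
      (≤-trans (source-shrinks (Shift-sym s)) (column-antitone (parts q) (<⇒≤ x<y)))
      (source-shrinks s))

  -- Corners that realise a shift

  padded-at : ∀ (p : Partition n) {i k} → (∀ {m} → m < k → toℕ i < col m p) → ¬ (toℕ i < col k p) →
    rows p i ≡ k
  padded-at p {i} {k} before at = ≤-antisym
    (≮⇒≥ (at ∘ padded>⇒<column (sorted p) i))
    (≮⇒≥ λ r<k → <-irrefl refl (<column⇒padded> (sorted p) i (before r<k)))

  -- The target is absent from the type, so one corner serves every shift out of column `x`. `index`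
  -- selects the last row longer than `x` and later separates source from target; `length≡` gives
  -- the column that loses a cell.
  record CornerFrom (p : Partition n) (x : ℕ) : Set where
    field
      corner  : RemovableCorner p
      index   : suc (toℕ (RemovableCorner.r corner)) ≡ col x p
      length≡ : rows p (RemovableCorner.r corner) ≡ suc x

  record CornerTo (p : Partition n) (y : ℕ) : Set where
    field
      corner  : AddableCorner p
      index   : toℕ (AddableCorner.r corner) ≡ col y p
      length≡ : rows p (AddableCorner.r corner) ≡ y

  cornerFrom : ∀ {p q x y} → Shift p q x y → CornerFrom p x
  cornerFrom {p} {x = x} s with col x p in eq | drop-after-source s (n<1+n x)
  -- The strict drop excludes an empty column `x`, and it keeps row `i` from being longer than
  -- `suc x`.
  ... | suc i | drop = record
    { corner  = record
      { row       = row
      ; removable = ≤-<-trans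
          (≮⇒≥ λ x<r → <-irrefl (sym eq) (≤-<-trans (≤-reflexive (cong suc (sym (toℕ-fromℕ< i<ℓ))))
            (padded>⇒<column (sorted p) (suc row) x<r)))
          (<column⇒padded> (sorted p) (inject₁ row) (≤-reflexive index))
      }
    ; index   = index
    ; length≡ = padded-at p
        (λ m≤x → ≤-trans (≤-reflexive index) (column-antitone (parts p) (s≤s⁻¹ m≤x)))
        (≤⇒≯ (≤-trans (s≤s⁻¹ drop) (≤-reflexive (sym toℕ-row))))
    }
    where
    i<ℓ : i < ℓ p
    i<ℓ = ≤-trans (≤-reflexive (sym eq)) (column≤length x (parts p))

    row : Fin (ℓ p)
    row = fromℕ< i<ℓ

    toℕ-row : toℕ (inject₁ row) ≡ i
    toℕ-row = trans (toℕ-inject₁ row) (toℕ-fromℕ< i<ℓ)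

    index : suc (toℕ (inject₁ row)) ≡ col x p
    index = trans (cong suc toℕ-row) (sym eq)

  -- Lengthening row `r` can only upset its comparison with the rows above, and a strict inequality
  -- there absorbs one cell.
  addable-at : (p : Partition n) (r : Fin (suc (ℓ p))) → (∀ {i} → i Fin.< r → rows p r < rows p i) →
    AddableCorner p
  addable-at p r above = record { r = r ; addable = AllPairs⇒Linked (tabulate⁺-< ordered) }
    where
    f = updateAt (rows p) r suc

    f≥rows : ∀ i → rows p i ≤ f i
    f≥rows i with i Fin.≟ r
    ... | yes refl = ≤-trans (n≤1+n _) (≤-reflexive (sym (updateAt-updates i (rows p))))
    ... | no  i≢r  = ≤-reflexive (sym (updateAt-minimal i r (rows p) i≢r))

    ordered : ∀ {i j} → i Fin.< j → f i ≥ f j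
    ordered {i} {j} i<j with j Fin.≟ r
    ... | yes refl = ≤-trans (≤-reflexive (updateAt-updates j (rows p)))
      (≤-trans (above i<j) (f≥rows i))
    ... | no  j≢r  = ≤-trans (≤-reflexive (updateAt-minimal j r (rows p) j≢r))
      (≤-trans (padded-antitone (sorted p) (<⇒≤ i<j)) (f≥rows i))

  cornerTo : ∀ {p q x y} → Shift p q x y → CornerTo p y
  cornerTo {p} {y = y} s = record
    { corner  = addable-at p r λ {i} i<r → ≤-<-trans (≤-reflexive length≡)
        (<column⇒padded> (sorted p) i (subst (toℕ i <_) index i<r))
    ; index   = index
    ; length≡ = length≡
    }
    where
    r : Fin (suc (ℓ p))
    -- The first row not longer than `y`. For `y = 0` its index is `ℓ p`, the empty row below the
    -- diagram.
    r = fromℕ< (s≤s (column≤length y (parts p)))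

    index : toℕ r ≡ col y p
    index = toℕ-fromℕ< (s≤s (column≤length y (parts p)))

    length≡ : rows p r ≡ y
    length≡ = padded-at p
      (λ m<y → ≤-<-trans (≤-reflexive index) (drop-before-target s m<y))
      (≤⇒≯ (≤-reflexive (sym index)))

  Shift⇒≢ : ∀ {p q x y} → Shift p q x y → q ≢ p
  Shift⇒≢ s refl = <-irrefl refl (source-shrinks s)

  -- The corners are separate arguments so that one can stay fixed while the other varies.
  -- `source≢target` makes their rows distinct; the moved rows then have the columns of `q`.
  Shift⇒transfer : ∀ {p q x y} → Shift p q x y → (c : CornerFrom p x) (a : CornerTo p y) →
    p ⟨ CornerFrom.corner c ⇒ CornerTo.corner a ⟩ q
  Shift⇒transfer {p} {q} {x} {y} s c a = record
    { distinct-rows = i≢j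
    ; cell-in-row   = subst (0 <_) (sym (CornerFrom.length≡ c)) z<s
    ; reordered     = columns⇒↭ (sorted q) (all-filter (0 <?_) (moved-rows p i j)) (positive q) columns≡
    } , Shift⇒≢ s
    where
    i = RemovableCorner.r (CornerFrom.corner c)
    j = AddableCorner.r (CornerTo.corner a)

    i≢j : i ≢ j
    i≢j i≡j = source≢target s (trans (sym (CornerFrom.index c))
      (cong suc (trans (cong toℕ i≡j) (CornerTo.index a))))

    columns≡ : ∀ k → column k (filter (0 <?_) (moved-rows p i j)) ≡ col k q
    columns≡ k = trans (column-filter k (moved-rows p i j)) (+-cancelʳ-≡ (δ x k) _ _
      (trans (column-moved-rows k p i≢j (CornerFrom.length≡ c))
        (trans (cong (λ z → col k p + δ z k) (CornerTo.length≡ a)) (sym (balance s k)))))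

-- A dichotomy for pairwise related elements

module _ {A : Set} {R : A → A → Set} where

  -- Comparing `a` with each later element in turn, either `a` acquires `Q` once, which settles the
  -- whole list, or every element acquires `P`.
  All-exchange : ∀ {P Q : Pred A 0ℓ} → (∀ {a b} → R a b → P a → Q b → P b ⊎ Q a) →
    ∀ {a xs} → P a → All (R a) xs → All Q xs → All P (a ∷ xs) ⊎ All Q (a ∷ xs)
  All-exchange exchange pa []       []       = inj₁ (pa ∷ [])
  All-exchange exchange pa (r ∷ rs) (q ∷ qs) with exchange r pa q
  ... | inj₂ qa = inj₂ (qa ∷ q ∷ qs)
  ... | inj₁ pb = Sum.map (λ { (pa ∷ ps) → pa ∷ pb ∷ ps }) (λ { (qa ∷ qs) → qa ∷ q ∷ qs })
    (All-exchange exchange pa rs qs)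

  All-dichotomy : ∀ {P Q : Pred A 0ℓ} →
    (∀ {a b} → R a b → P a → Q b → P b ⊎ Q a) → (∀ {a b} → R a b → Q a → P b → Q b ⊎ P a) →
    ∀ {xs} → AllPairs R xs → All (λ a → P a ⊎ Q a) xs → All P xs ⊎ All Q xs
  All-dichotomy pq qp [] [] = inj₁ []
  All-dichotomy pq qp (ra ∷ rs) (pqa ∷ pqs) with All-dichotomy pq qp rs pqs | pqa
  ... | inj₁ ps | inj₁ pa = inj₁ (pa ∷ ps)
  ... | inj₂ qs | inj₂ qa = inj₂ (qa ∷ qs)
  ... | inj₂ qs | inj₁ pa = All-exchange pq pa ra qs
  ... | inj₁ ps | inj₂ qa = Sum.swap (All-exchange qp qa ra ps)

-- The first property supplies `admissible` for the simplex, the second the membership of the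
-- vertices in it.
All-witnesses : ∀ {A B : Set} {T : A → B → Set} {bs} → All (λ b → ∃[ a ] T a b) bs →
  ∃[ as ] (∀ {a} → a ∈ as → ∃[ b ] T a b) × (∀ {b} → b ∈ bs → ∃[ a ] (a ∈ as × T a b))
All-witnesses [] = [] , (λ ()) , λ ()
All-witnesses {bs = b ∷ _} ((a , t) ∷ ts) with All-witnesses ts
... | as , sound , complete = a ∷ as
  , (λ { (here refl) → b , t ; (there a∈as) → sound a∈as })
  , (λ { (here refl)  → a , here refl , t
       ; (there b∈bs) → let a′ , a′∈as , t′ = complete b∈bs in a′ , there a′∈as , t′ })

-- Covering a clique by a simplex

star-cover : ∀ {n} {p : Partition n} {qs} (c : RemovableCorner p) →
  All (λ q → ∃[ a ] p ⟨ c ⇒ a ⟩ q) qs →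
  ∃[ S ] (∀ {q} → q ∈ p ∷ qs → StarSimplex.vertices S q)
star-cover {p = p} c ts with All-witnesses ts
... | as , sound , complete =
  record { base = p ; c = c ; A = as ; admissible = sound } ,
  λ { (here q≡p) → inj₁ q≡p ; (there q∈qs) → inj₂ (complete q∈qs) }

top-cover : ∀ {n} {p : Partition n} {qs} (a : AddableCorner p) →
  All (λ q → ∃[ c ] p ⟨ c ⇒ a ⟩ q) qs →
  ∃[ T ] (∀ {q} → q ∈ p ∷ qs → TopSimplex.vertices T q)
top-cover {p = p} a ts with All-witnesses ts
... | cs , sound , complete =
  record { base = p ; a = a ; C = cs ; admissible = sound } ,
  λ { (here q≡p) → inj₁ q≡p ; (there q∈qs) → inj₂ (complete q∈qs) }

Adjacent-sym : ∀ {n} {p q : Partition n} → Adjacent p q → Adjacent q p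
Adjacent-sym (p≢q , o) = ≢-sym p≢q , Sum.swap o

-- Seen from `p`, vertices are points of a grid, and each lies on one of the two lines through the
-- point `(x , y)` of `q`. Points on different lines, both off `(x , y)`, share no coordinate and so
-- cannot be adjacent.
common-column : ∀ {n} {p : Partition n} {q qs x y} → Shift p q x y →
  All (Adjacent p) qs → AllPairs Adjacent (q ∷ qs) →
  All (λ q′ → ∃[ y′ ] Shift p q′ x y′) (q ∷ qs) ⊎ All (λ q′ → ∃[ x′ ] Shift p q′ x′ y) (q ∷ qs)
common-column {p = p} {q} {qs} {x} {y} s p~qs pairs@(q~qs ∷ _) =
  All-dichotomy exchange (λ q~q′ Qq Pq′ → Sum.swap (exchange (Adjacent-sym q~q′) Pq′ Qq))
    pairs (inj₁ (y , s) ∷ All.zipWith shares (p~qs , q~qs))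
  where
  P Q : Partition _ → Set
  P q′ = ∃[ y′ ] Shift p q′ x y′
  Q q′ = ∃[ x′ ] Shift p q′ x′ y

  shares : ∀ {q′} → Adjacent p q′ × Adjacent q q′ → P q′ ⊎ Q q′
  shares (p~q′ , q~q′) with Adjacent⇒Shift p~q′
  ... | x′ , y′ , s′ with shared-column s s′ q~q′
  ... | inj₁ refl = inj₁ (y′ , s′)
  ... | inj₂ refl = inj₂ (x′ , s′)

  exchange : ∀ {q₁ q₂} → Adjacent q₁ q₂ → P q₁ → Q q₂ → P q₂ ⊎ Q q₁
  exchange q₁~q₂ (y₁ , s₁) (x₂ , s₂) with shared-column s₁ s₂ q₁~q₂
  ... | inj₁ refl = inj₁ (y , s₂)
  ... | inj₂ refl = inj₂ (x , s₁)

theorem3p6 : ∀ (n : ℕ) → n ≥ 1 → (K : Clique n) →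
    (∃[ S ] K ⊆ˢ S) ⊎ (∃[ T ] K ⊆ᵗ T)
theorem3p6 n _ record { vertices = [] ; nonempty = nonempty } = contradiction refl nonempty
-- No row lies above the first, so a cell can always be added there; the set of removable corners is
-- empty.
theorem3p6 n _ record { vertices = p ∷ [] } = inj₂ (top-cover (addable-at p zero λ ()) [])
theorem3p6 n _ record { vertices = p ∷ q ∷ qs ; pairwise = (p~q ∷ p~qs) ∷ pairs }
  with Adjacent⇒Shift p~q
... | x , y , s with common-column s p~qs pairs
-- The corner found for the first neighbour is reused for all, since its type mentions only `p` and
-- `x`.
... | inj₁ same-x = inj₁ (star-cover (CornerFrom.corner c)
        (All.map (λ { (_ , t) → CornerTo.corner (cornerTo t) , Shift⇒transfer t c (cornerTo t) }) same-x))
  where c = cornerFrom s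
... | inj₂ same-y = inj₂ (top-cover (CornerTo.corner a)
        (All.map (λ { (_ , t) → CornerFrom.corner (cornerFrom t) , Shift⇒transfer t (cornerFrom t) a }) same-y))
  where a = cornerTo s
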